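{- Let $\frac23\le M<\frac34$. Algorithm D (defined in the context) has migration factor at most $M$, and on every input whose optimal offline makespan is $1$ it produces a schedule of makespan at most $2-M$. Hence its competitive ratio is at most $2-M$.
   Context: Model (two hierarchical machines with migration, bin stretching). Jobs $1,2,\dots,n$ arrive one by one ($n$ unknown in advance). Job $j$ has a size $p_j>0$ and a grade of service (GoS) $g_j\in\{1,2\}$; a job of GoS $1$ may only be processed on machine $m_1$, a job of GoS $2$ may be processed on $m_1$ or on $m_2$. The load of a machine is the total size of its jobs, the makespan is the maximum load. When job $j$ arrives, the algorithm must assign it, and may migrate previously arrived jobs (respecting GoS) of total size at most $M\cdot p_j$ (migration factor $M$). Bin stretching: the optimal offline makespan of the complete input is known in advance and scaled to $1$. The competitive ratio is the supremum over inputs of (algorithm's makespan)/(optimal makespan). Notation: $Y_{j}$ is the set of jobs on $m_2$ just after job $j$ has been handled, $y_j$ its total size, $y_0=0$; "sorted $Y_{j-1}$" lists $Y_{j-1}$ in non-increasing order of size; $w_j$ is the total size of the (current) set $W$. Algorithm D (parameter $M$). On arrival of job $j$: Step 2: if $g_j=1$ or $y_{j-1}\ge M$, assign $j$ to $m_1$. Step 3: else if $y_{j-1}+p_j\le 2-M$, assign $j$ to $m_2$. Step 4: else if $p_j\ge M$: let $W$ be the longest prefix of sorted $Y_{j-1}$ with total size at most $M\cdot p_j$ (possibly empty). If $y_{j-1}-w_j+p_j>2-M$, assign $j$ to $m_1$; otherwise migrate the jobs of $W$ to $m_1$ and assign $j$ to $m_2$. Step 5: else (so $p_j<M$): let $W$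 be the shortest prefix of sorted $Y_{j-1}$ with total size at least $M/3$ (or $Y_{j-1}$ if none exists). If $w_j>\min\{2M/3,\,M\cdot p_j\}$, replace $W$ by $Y_{j-1}\setminus W$. Then, if $y_{j-1}-w_j+p_j>2-M$, assign $j$ to $m_1$; otherwise migrate the jobs of $W$ to $m_1$ and assign $j$ to $m_2$. -}

module Defs where

open import Level using (Level)
open import Algebra.Core using (Op₁; Op₂)
open import Algebra.Structures using (IsCommutativeRing)
open import Algebra.Bundles using (CommutativeRing)
open import Data.Bool.Base using (if_then_else_; _∨_)
open import Data.Fin.Base using (Fin)
import Data.Fin.Properties as Fin
open import Data.List.Base using (List; []; map; foldr; filter; find; inits; reverse; allFin)
import Data.List.Membership.DecPropositional as DecMembership
open import Data.List.Sort.Base using (SortingAlgorithm)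
open import Data.Maybe.Base using (fromMaybe)
open import Data.Nat.Base as ℕ using (ℕ)
open import Data.Product.Base using (∃; _×_)
open import Data.Vec.Base using (Vec; []; _∷_; lookup; tabulate)
open import Relation.Binary.Bundles using (TotalOrder; DecTotalOrder; StrictTotalOrder)
open import Relation.Binary.Core using (Rel)
open import Relation.Binary.Definitions using (DecidableEquality)
open import Relation.Binary.PropositionalEquality.Core using (refl)
open import Relation.Binary.Structures using (IsDecTotalOrder)
import Algebra.Construct.NaturalChoice.Max as Max
import Algebra.Construct.NaturalChoice.Min as Min
import Relation.Binary.Construct.Flip.EqAndOrd as Flip
import Relation.Binary.Construct.On as On
import Relation.Binary.Properties.DecTotalOrder as DecTotalOrderProperties
open import Relation.Nullary.Decidable.Core using (yes; no; does; ¬?)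
open import Relation.Nullary.Negation.Core using (¬_)

-- The library has no real numbers. Sizes and the parameter M are taken from an
-- arbitrary linearly ordered field with decidable comparison, of which ℝ is
-- (classically) an instance.

record OrderedField (c ℓ₁ ℓ₂ : Level) : Set (Level.suc (c Level.⊔ ℓ₁ Level.⊔ ℓ₂)) where
  infix  8 _⁻¹ -_
  infixl 7 _*_ _/_
  infixl 6 _+_ _-_
  infix  4 _≈_ _≤_
  field
    Carrier           : Set c
    _≈_               : Rel Carrier ℓ₁
    _≤_               : Rel Carrier ℓ₂
    _+_               : Op₂ Carrier
    _*_               : Op₂ Carrier
    -_                : Op₁ Carrier
    0#                : Carrier
    1#                : Carrier
    _⁻¹               : Op₁ Carrier
    isCommutativeRing : IsCommutativeRing _≈_ _+_ _*_ -_ 0# 1#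
    isDecTotalOrder   : IsDecTotalOrder _≈_ _≤_
    0#≉1#             : ¬ (0# ≈ 1#)
    -- Inversion is total; the value of 0# ⁻¹ is unconstrained.
    *-inverseʳ        : ∀ x → ¬ (x ≈ 0#) → x * x ⁻¹ ≈ 1#
    +-monoˡ-≤         : ∀ z {x y} → x ≤ y → x + z ≤ y + z
    *-nonNeg          : ∀ {x y} → 0# ≤ x → 0# ≤ y → 0# ≤ x * y

  commutativeRing : CommutativeRing c ℓ₁
  commutativeRing = record { isCommutativeRing = isCommutativeRing }

  decTotalOrder : DecTotalOrder c ℓ₁ ℓ₂
  decTotalOrder = record { isDecTotalOrder = isDecTotalOrder }

  open DecTotalOrder decTotalOrder public using (totalOrder; _≤?_)
  open DecTotalOrderProperties decTotalOrder public using (_<_; <-strictTotalOrder)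
  open StrictTotalOrder <-strictTotalOrder public using (_<?_)
  open Min totalOrder public using (_⊓_)
  open Max totalOrder public using (_⊔_)

  _-_ _/_ : Op₂ Carrier
  x - y = x + (- y)
  x / y = x * y ⁻¹

  2# 3# 4# : Carrier
  2# = 1# + 1#
  3# = 2# + 1#
  4# = 3# + 1#

data GoS : Set where
  gos₁ gos₂ : GoS

data Machine : Set where
  m₁ m₂ : Machine

data _mayRunOn_ : GoS → Machine → Set where
  gos₁-m₁ : gos₁ mayRunOn m₁
  gos₂-m₁ : gos₂ mayRunOn m₁
  gos₂-m₂ : gos₂ mayRunOn m₂

_≟ᵍ_ : DecidableEquality GoS
gos₁ ≟ᵍ gos₁ = yes refl
gos₁ ≟ᵍ gos₂ = no λ ()
gos₂ ≟ᵍ gos₁ = no λ ()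
gos₂ ≟ᵍ gos₂ = yes refl

_≟ᵐ_ : DecidableEquality Machine
m₁ ≟ᵐ m₁ = yes refl
m₁ ≟ᵐ m₂ = no λ ()
m₂ ≟ᵐ m₁ = no λ ()
m₂ ≟ᵐ m₂ = yes refl

-- σ gives the machine of each job, by position in the input.
Schedule : ℕ → Set
Schedule n = Vec Machine n

jobsOn : ∀ {n} → Machine → Schedule n → List (Fin n)
jobsOn m σ = filter (λ i → lookup σ i ≟ᵐ m) (allFin _)

module Scheduling {c ℓ₁ ℓ₂} (𝔽 : OrderedField c ℓ₁ ℓ₂) where
  open OrderedField 𝔽

  record Job : Set (c Level.⊔ ℓ₁ Level.⊔ ℓ₂) where
    field
      size     : Carrier
      size-pos : 0# < size
      gos      : GoS

  open Job public

  -- Inputs are listed newest job first: j ∷ js is the input js followed by the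
  -- arrival of j, so the inputs seen earlier are the suffixes of the vector.
  Input : ℕ → Set (c Level.⊔ ℓ₁ Level.⊔ ℓ₂)
  Input n = Vec Job n

  sizeAt : ∀ {n} → Input n → Fin n → Carrier
  sizeAt js i = size (lookup js i)

  total : ∀ {n} → Input n → List (Fin n) → Carrier
  total js is = foldr _+_ 0# (map (sizeAt js) is)

  load : ∀ {n} → Input n → Schedule n → Machine → Carrier
  load js σ m = total js (jobsOn m σ)

  makespan : ∀ {n} → Input n → Schedule n → Carrier
  makespan js σ = load js σ m₁ ⊔ load js σ m₂

  Feasible : ∀ {n} → Input n → Schedule n → Set
  Feasible js σ = ∀ i → gos (lookup js i) mayRunOn lookup σ i

  IsOptimalMakespan : ∀ {n} → Input n → Carrier → Set (ℓ₁ Level.⊔ ℓ₂)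
  IsOptimalMakespan js v =
    (∃ λ σ → Feasible js σ × makespan js σ ≈ v) ×
    (∀ σ → Feasible js σ → v ≤ makespan js σ)

  -- An algorithm is online because its schedule after each arrival depends only
  -- on the jobs seen so far; the number of jobs still to come is unknown to it.
  OnlineAlgorithm : Set (c Level.⊔ ℓ₁ Level.⊔ ℓ₂)
  OnlineAlgorithm = ∀ {n} → Input n → Schedule n

  RespectsGoS : OnlineAlgorithm → Set (c Level.⊔ ℓ₁ Level.⊔ ℓ₂)
  RespectsGoS A = ∀ {n} (js : Input n) → Feasible js (A js)

  -- Position i of σ becomes position suc i of σ′.
  migrated : ∀ {n} → Schedule n → Schedule (ℕ.suc n) → List (Fin n)
  migrated σ (_ ∷ σ′) = filter (λ i → ¬? (lookup σ i ≟ᵐ lookup σ′ i)) (allFin _)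

  MigrationFactorAtMost : OnlineAlgorithm → Carrier → Set (c Level.⊔ ℓ₁ Level.⊔ ℓ₂)
  MigrationFactorAtMost A μ = ∀ {n} (j : Job) (js : Input n) →
    total js (migrated (A js) (A (j ∷ js))) ≤ μ * size j

  -- The inputs of bin stretching are those of optimal makespan 1. That the
  -- supremum of their ratios is at most r says that r bounds every ratio.
  CompetitiveRatioAtMost : OnlineAlgorithm → Carrier → Set (c Level.⊔ ℓ₁ Level.⊔ ℓ₂)
  CompetitiveRatioAtMost A r = ∀ {n} (js : Input n) opt →
    IsOptimalMakespan js opt → opt ≈ 1# → makespan js (A js) / opt ≤ r

  byDecreasingSize : ∀ {n} → Input n → TotalOrder _ _ _
  byDecreasingSize js = On.totalOrder (Flip.totalOrder totalOrder) (sizeAt js)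

  -- Ties between jobs of equal size are broken by the choice of Sorter.
  Sorter : Set (c Level.⊔ ℓ₁ Level.⊔ ℓ₂)
  Sorter = ∀ {n} (js : Input n) → SortingAlgorithm (byDecreasingSize js)

  module AlgorithmD (sorter : Sorter) (M : Carrier) where

    data Decision (n : ℕ) : Set where
      assignTo-m₁        : Decision n
      migrate_assignTo-m₂ : List (Fin n) → Decision n

    -- inits lists the prefixes by increasing length.
    longestPrefixAtMost : ∀ {n} → Input n → Carrier → List (Fin n) → List (Fin n)
    longestPrefixAtMost js b is =
      fromMaybe [] (find (λ W → total js W ≤? b) (reverse (inits is)))

    shortestPrefixAtLeast : ∀ {n} → Input n → Carrier → List (Fin n) → List (Fin n)
    shortestPrefixAtLeast js b is =
      fromMaybe is (find (λ W → b ≤? total js W) (inits is))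

    _∖_ : ∀ {n} → List (Fin n) → List (Fin n) → List (Fin n)
    is ∖ W = filter (λ i → ¬? (i ∈? W)) is
      where open DecMembership Fin._≟_ using (_∈?_)

    step₄ : ∀ {n} → Input n → Carrier → List (Fin n) → List (Fin n)
    step₄ js p Y↓ = longestPrefixAtMost js (M * p) Y↓

    step₅ : ∀ {n} → Input n → Carrier → List (Fin n) → List (Fin n)
    step₅ js p Y↓ =
      if does (((2# * M) / 3#) ⊓ (M * p) <? total js W) then Y↓ ∖ W else W
      where W = shortestPrefixAtLeast js (M / 3#) Y↓

    decide : ∀ {n} → Job → Input n → Schedule n → Decision n
    decide {n} j js σ =
      if does (gos j ≟ᵍ gos₁) ∨ does (M ≤? y) then assignTo-m₁
      else if does (y + p ≤? 2# - M) then migrate [] assignTo-m₂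
      else if does (M ≤? p) then tryMigrating (step₄ js p Y↓)
      else tryMigrating (step₅ js p Y↓)
      where
      p  = size j
      Y  = jobsOn m₂ σ
      Y↓ = SortingAlgorithm.sort (sorter js) Y
      y  = total js Y

      tryMigrating : List (Fin n) → Decision n
      tryMigrating W =
        if does (2# - M <? (y - total js W) + p)
        then assignTo-m₁
        else migrate W assignTo-m₂

    execute : ∀ {n} → Decision n → Schedule n → Schedule (ℕ.suc n)
    execute assignTo-m₁ σ = m₁ ∷ σ
    execute (migrate W assignTo-m₂) σ =
      m₂ ∷ tabulate λ i → if does (i ∈? W) then m₁ else lookup σ i
      where open DecMembership Fin._≟_ using (_∈?_)

    algorithmD : OnlineAlgorithm
    algorithmD []       = []
    algorithmD (j ∷ js) = execute (decide j js σ) σ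
      where σ = algorithmD js

-- Write y for the load of m₂, and compare with a schedule τ of makespan at most 1.
-- A job p reaching step 4 or 5 has p > 2 − 2M > 1/2, and in both steps the set W
-- satisfies w ≤ y + p − M, so that accepting p brings y to at least M, after which
-- the total load 2 of τ leaves at most 2 − M for m₁. Rejecting p is only possible
-- when m₂ holds jobs A each of which exceeds 1 together with p, with total
-- a ≥ p − (1 − M): in step 4 the prefix W and the job following it, in step 5 the
-- first job alone. Hence τ separates p from A, so either p itself or A lies on m₁
-- in τ next to the jobs of GoS 1, and the load of m₁ exceeds that in τ by at most
-- 1 − M. Since both p and a are at least 2M − 1, no machine of τ has room for
-- another job larger than 2 − 2M, so that at most one job is rejected while y < M.

module Submission where

open import Defs
open import Algebra.Bundles using (CommutativeRing)
import Algebra.Construct.NaturalChoice.Max as Max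
import Algebra.Construct.NaturalChoice.MaxOp as MaxOp
import Algebra.Construct.NaturalChoice.Min as Min
import Algebra.Construct.NaturalChoice.MinOp as MinOp
import Algebra.Properties.Semiring.Mult.TCOptimised as Mult
import Algebra.Solver.Ring.NaturalCoefficients.Default as NaturalCoefficients
open import Data.Bool.Base using (if_then_else_)
open import Data.Empty using (⊥)
open import Data.Fin.Base using (Fin; zero; suc)
import Data.Fin.Properties as Fin
open import Data.List.Base using (List; []; _∷_; _++_; _∷ʳ_; [_]; map; filter; find; inits; reverse; allFin; initLast; _∷ʳ′_)
import Data.List.Membership.DecPropositional as DecMembership
open import Data.List.Membership.Propositional using (_∈_; _∉_)
open import Data.List.Membership.Propositional.Properties using (∈-++⁺ˡ; ∈-++⁺ʳ; ∈-++⁻; ∈-∃++; ∈-filter⁺; ∈-filter⁻; ∈-allFin; ∈-map⁺; ∈-map⁻)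
open import Data.List.Properties using (++-assoc; filter-++; filter-all; filter-none; reverse-map; unfold-reverse)
open import Data.List.Relation.Binary.Permutation.Propositional using (↭⇒↭ₛ; ↭-sym)
open import Data.List.Relation.Binary.Permutation.Propositional.Properties using (∈-resp-↭)
import Data.List.Relation.Binary.Permutation.Setoid.Properties as Permutationₛ
open import Data.List.Relation.Binary.Subset.Propositional using (_⊆_)
open import Data.List.Relation.Unary.All as All using (All; []; _∷_)
import Data.List.Relation.Unary.All.Properties as All
open import Data.List.Relation.Unary.AllPairs using (AllPairs; []; _∷_)
open import Data.List.Relation.Unary.Any using (here; there)
open import Data.List.Relation.Unary.Sorted.TotalOrder.Properties using (Sorted⇒AllPairs)
open import Data.List.Relation.Unary.Unique.Propositional using (Unique)
import Data.List.Relation.Unary.Unique.Propositional.Properties as Unique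
open import Data.List.Sort.Base using (SortingAlgorithm)
open import Data.Maybe.Base as Maybe using (Maybe; just; nothing)
open import Data.Nat.Base using (zero; suc)
open import Data.Product.Base using (∃; _×_; _,_; proj₁; proj₂)
open import Data.Sum.Base using (_⊎_; inj₁; inj₂)
open import Data.Vec.Base using ([]; _∷_; lookup; tabulate)
open import Data.Vec.Properties using (lookup∘tabulate; tabulate∘lookup)
open import Function.Base using (_∘_)
import Level
open import Relation.Binary.Bundles using (DecTotalOrder)
open import Relation.Binary.Core using (Rel)
import Relation.Binary.Properties.DecTotalOrder as DecTotalOrderProperties
open import Relation.Binary.PropositionalEquality as ≡ using (_≡_; _≢_; cong; subst; module ≡-Reasoning)
open import Relation.Nullary.Decidable.Core using (yes; no; does; ¬?)
open import Relation.Nullary.Negation.Core using (¬_; contradiction)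
open import Relation.Unary using (Pred; Decidable)

-- Order arithmetic without subtraction.

module OrderedFieldProperties {c ℓ₁ ℓ₂} (𝔽 : OrderedField c ℓ₁ ℓ₂) where
  open OrderedField 𝔽
  open CommutativeRing commutativeRing public
    using ( +-cong; +-congˡ; +-congʳ; +-assoc; +-comm; +-identityˡ; +-identityʳ
          ; *-cong; *-congˡ; *-congʳ; *-identityˡ; *-identityʳ; zeroˡ; zeroʳ
          ; -‿inverseˡ; -‿inverseʳ; semiring; commutativeSemiring; refl; sym; trans)
  open DecTotalOrder decTotalOrder public
    using (≤-respˡ-≈; ≤-respʳ-≈; antisym)
    renaming (refl to ≤-refl; reflexive to ≤-reflexive; trans to ≤-trans; total to ≤-total)
  open DecTotalOrderProperties decTotalOrder public
    using (≰⇒>; <⇒≱; ≮⇒≥; <-respˡ-≈; <-respʳ-≈)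
  open Mult semiring public using () renaming (_×_ to _·_)
  open NaturalCoefficients commutativeSemiring public
    using (solve; con; _:+_; _:*_; _:=_)

  <⇒≤ : ∀ {x y} → x < y → x ≤ y
  <⇒≤ = proj₁

  y-x+x≈y : ∀ y x → (y - x) + x ≈ y
  y-x+x≈y y x = trans (+-assoc y (- x) x) (trans (+-congˡ (-‿inverseˡ x)) (+-identityʳ y))

  +-cancelʳ-≤ : ∀ z {x y} → x + z ≤ y + z → x ≤ y
  +-cancelʳ-≤ z {x} {y} le =
    ≤-respˡ-≈ (cancel x) (≤-respʳ-≈ (cancel y) (+-monoˡ-≤ (- z) le))
    where
    cancel : ∀ x → (x + z) + (- z) ≈ x
    cancel x = trans (+-assoc x z (- z)) (trans (+-congˡ (-‿inverseʳ z)) (+-identityʳ x))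

  infixl 6 _⊕_
  infixl 5 _⊕<_

  _⊕_ : ∀ {x y z w} → x ≤ y → z ≤ w → x + z ≤ y + w
  _⊕_ {x} {y} {z} {w} x≤y z≤w = ≤-trans (+-monoˡ-≤ z x≤y)
    (≤-respˡ-≈ (+-comm z y) (≤-respʳ-≈ (+-comm w y) (+-monoˡ-≤ y z≤w)))

  _⊕<_ : ∀ {x y z w} → x < y → z ≤ w → x + z < y + w
  _⊕<_ {z = z} x<y z≤w = ≰⇒> λ y+w≤x+z →
    <⇒≱ x<y (+-cancelʳ-≤ z (≤-trans (≤-refl ⊕ z≤w) y+w≤x+z))

  -- Inequalities are deduced from nonnegative combinations of others by semiring
  -- identities, with each term moved to the side on which no subtraction occurs.
  linear-≤ : ∀ {a b c d} → c ≤ d → a + d ≈ b + c → a ≤ b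
  linear-≤ {a} {b} {c} {d} c≤d eq =
    +-cancelʳ-≤ c (≤-trans (≤-refl ⊕ c≤d) (≤-reflexive eq))

  linear-< : ∀ {a b c d} → c < d → a + d ≈ b + c → a < b
  linear-< {a} {b} {c} {d} c<d eq = ≰⇒> λ b≤a →
    <⇒≱ c<d (linear-≤ b≤a (trans (+-comm d a) (trans eq (+-comm b c))))

  linear-⊥ : ∀ {c d} → c < d → d ≈ c → ⊥
  linear-⊥ c<d d≈c = <⇒≱ c<d (≤-reflexive d≈c)

  ∃-difference : ∀ {x y} → x ≤ y → ∃ λ t → 0# ≤ t × x + t ≈ y
  ∃-difference {x} {y} x≤y =
    y - x , +-cancelʳ-≤ x (≤-respˡ-≈ (sym (+-identityˡ x)) (≤-respʳ-≈ (sym (y-x+x≈y y x)) x≤y)) ,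
    trans (+-comm x (y - x)) (y-x+x≈y y x)

  -- This is `(y - x) * (w - z) ≥ 0` multiplied out, with the negative terms moved across. Later
  -- comparisons of products, such as `M * M` with `M * p`, are instances of it.
  *-rearrange : ∀ {x y z w} → x ≤ y → z ≤ w → x * w + y * z ≤ y * w + x * z
  *-rearrange {x} {y} {z} {w} x≤y z≤w with ∃-difference x≤y | ∃-difference z≤w
  ... | t , 0≤t , x+t≈y | s , 0≤s , z+s≈w =
    ≤-respˡ-≈ (+-cong (*-congˡ z+s≈w) (*-congʳ x+t≈y))
      (≤-respʳ-≈ (+-cong (*-cong x+t≈y z+s≈w) refl)
        (linear-≤ (*-nonNeg 0≤t 0≤s)
          (solve 4 (λ x z t s → (x :* (z :+ s) :+ (x :+ t) :* z) :+ t :* s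
                             := ((x :+ t) :* (z :+ s) :+ x :* z) :+ con 0) refl x z t s)))

  0≤1 : 0# ≤ 1#
  0≤1 with ≤-total 0# 1#
  ... | inj₁ 0≤1 = 0≤1
  -- Even under this assumption the product of `0 - 1` with itself is nonnegative, and that product
  -- is 1.
  ... | inj₂ 1≤0 = linear-≤ (*-rearrange 1≤0 1≤0)
    (solve 0 (con 0 :+ (con 0 :* con 0 :+ con 1 :* con 1)
           := con 1 :+ (con 1 :* con 0 :+ con 0 :* con 1)) refl)

  0<1 : 0# < 1#
  0<1 = 0≤1 , 0#≉1#

  0≤·1 : ∀ n → 0# ≤ n · 1#
  0≤·1 zero = ≤-refl
  0≤·1 (suc n) = ≤-respʳ-≈ (sym (1+× n 1#)) (≤-respˡ-≈ (+-identityʳ 0#) (0≤1 ⊕ 0≤·1 n))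
    where open Mult semiring using (1+×)

  -- The multiples `2 · 1#`, `3 · 1#` and `4 · 1#` unfold to `2#`, `3#` and `4#`, so these factors
  -- match the numerals of the problem directly.
  scale : ∀ n {x y} → x ≤ y → (n · 1#) * x ≤ (n · 1#) * y
  scale n {x} {y} x≤y = linear-≤ (*-rearrange (0≤·1 n) x≤y)
    (solve 3 (λ k x y → k :* x :+ (k :* y :+ con 0 :* x) := k :* y :+ (con 0 :* y :+ k :* x))
      refl (n · 1#) x y)

  -- If `y < x`, one strict copy of this and `n` weak copies contradict the hypothesis. The
  -- cancelled factor is `suc n`, so `scale⁻¹ 2` divides by three.
  scale⁻¹ : ∀ n {x y} → (suc n · 1#) * x ≤ (suc n · 1#) * y → x ≤ y
  scale⁻¹ n {x} {y} nx≤ny = ≮⇒≥ λ y<x → <⇒≱ (y<x ⊕< scale n (<⇒≤ y<x))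
    (≤-respˡ-≈ (expand x) (≤-respʳ-≈ (expand y) nx≤ny))
    where
    open Mult semiring using (1+×)
    expand : ∀ z → (suc n · 1#) * z ≈ z + (n · 1#) * z
    expand z = trans (*-congʳ (1+× n 1#))
      (solve 2 (λ k z → (con 1 :+ k) :* z := z :+ k :* z) refl (n · 1#) z)

-- Splittings of lists and searches among prefixes.

AllPairs-++⁻ : ∀ {a ℓ} {A : Set a} {R : Rel A ℓ} xs {ys} → AllPairs R (xs ++ ys) →
  AllPairs R xs × AllPairs R ys × All (λ x → All (R x) ys) xs
AllPairs-++⁻ [] rs = [] , rs , []
AllPairs-++⁻ (x ∷ xs) (r ∷ rs) with AllPairs-++⁻ xs rs
... | rxs , rys , rxys = (All.++⁻ˡ xs r ∷ rxs) , rys , (All.++⁻ʳ xs r ∷ rxys)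

-- Turns the set difference of step 5 into the suffix behind the prefix. Distinctness keeps entries
-- of that suffix from being filtered out too.
filter-∉-++ : ∀ {n} (xs ys : List (Fin n)) → Unique (xs ++ ys) →
  let open DecMembership Fin._≟_ using (_∈?_) in
  filter (λ i → ¬? (i ∈? xs)) (xs ++ ys) ≡ ys
filter-∉-++ {n} xs ys unq =
  ≡.trans (filter-++ P? xs ys)
    (≡.cong₂ _++_ (filter-none P? (All.tabulate λ i∈xs i∉xs → i∉xs i∈xs))
      (filter-all P? (All.tabulate λ j∈ys j∈xs →
        All.lookup (All.lookup (proj₂ (proj₂ (AllPairs-++⁻ xs unq))) j∈xs) j∈ys ≡.refl)))
  where
  open DecMembership Fin._≟_ using (_∈?_)
  P? = λ i → ¬? (i ∈? xs)

module _ {a p : Level.Level} {A : Set a} where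

  -- Maximality is recorded as failure of `P` on the prefix with one more entry, because that longer
  -- prefix is what blocks a job in step 4.
  data LastPrefix (P : Pred (List A) p) (xs : List A) : Maybe (List A) → Set (a Level.⊔ p) where
    none : ¬ P [] → LastPrefix P xs nothing
    some : ∀ {ws} zs → P ws → ws ++ zs ≡ xs → (∀ q qs → zs ≡ q ∷ qs → ¬ P (ws ∷ʳ q)) →
      LastPrefix P xs (just ws)

  data FirstPrefix (P : Pred (List A) p) (xs : List A) : Maybe (List A) → Set (a Level.⊔ p) where
    none : ¬ P xs → FirstPrefix P xs nothing
    some : ∀ {ws} zs → P ws → ws ++ zs ≡ xs → (∀ vs x → vs ∷ʳ x ≡ ws → ¬ P vs) →
      FirstPrefix P xs (just ws)

  find-map : ∀ {P : Pred (List A) p} (P? : Decidable P) (f : List A → List A) xss →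
    find P? (map f xss) ≡ Maybe.map f (find (P? ∘ f) xss)
  find-map P? f [] = ≡.refl
  find-map P? f (xs ∷ xss) with P? (f xs)
  ... | yes _ = ≡.refl
  ... | no _  = find-map P? f xss

  find-∷ʳ : ∀ {P : Pred (List A) p} (P? : Decidable P) xss ys →
    find P? (xss ∷ʳ ys) ≡ (find P? xss Maybe.<∣> find P? [ ys ])
  find-∷ʳ P? [] ys = ≡.refl
  find-∷ʳ P? (xs ∷ xss) ys with P? xs
  ... | yes _ = ≡.refl
  ... | no _  = find-∷ʳ P? xss ys

  -- Supplies the recursion for `lastPrefix`: the longest-first search tries all prefixes starting
  -- with `x` and falls back on `[]`.
  find-reverse-inits-∷ : ∀ {P : Pred (List A) p} (P? : Decidable P) x xs →
    find P? (reverse (inits (x ∷ xs))) ≡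
    (Maybe.map (x ∷_) (find (P? ∘ (x ∷_)) (reverse (inits xs))) Maybe.<∣> find P? [ [] ])
  find-reverse-inits-∷ P? x xs = begin
    find P? (reverse ([] ∷ map (x ∷_) (inits xs)))
      ≡⟨ cong (find P?) (unfold-reverse [] (map (x ∷_) (inits xs))) ⟩
    find P? (reverse (map (x ∷_) (inits xs)) ∷ʳ [])
      ≡⟨ find-∷ʳ P? (reverse (map (x ∷_) (inits xs))) [] ⟩
    (find P? (reverse (map (x ∷_) (inits xs))) Maybe.<∣> find P? [ [] ])
      ≡⟨ cong (λ xss → find P? xss Maybe.<∣> find P? [ [] ]) (reverse-map (x ∷_) (inits xs)) ⟨
    (find P? (map (x ∷_) (reverse (inits xs))) Maybe.<∣> find P? [ [] ])
      ≡⟨ cong (Maybe._<∣> find P? [ [] ]) (find-map P? (x ∷_) (reverse (inits xs))) ⟩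
    (Maybe.map (x ∷_) (find (P? ∘ (x ∷_)) (reverse (inits xs))) Maybe.<∣> find P? [ [] ]) ∎
    where open ≡-Reasoning

  lastPrefix : ∀ {P : Pred (List A) p} (P? : Decidable P) xs →
    LastPrefix P xs (find P? (reverse (inits xs)))
  lastPrefix P? [] with P? []
  ... | yes P[] = some [] P[] ≡.refl λ _ _ ()
  ... | no ¬P[] = none ¬P[]
  lastPrefix P? (x ∷ xs)
    rewrite find-reverse-inits-∷ P? x xs
    with find (P? ∘ (x ∷_)) (reverse (inits xs)) | lastPrefix (P? ∘ (x ∷_)) xs
  ... | just ws | some zs Pxws eq max = some zs Pxws (cong (x ∷_) eq) max
  ... | nothing | none ¬P[x] with P? []
  ...   | yes P[] = some (x ∷ xs) P[] ≡.refl λ { _ _ ≡.refl → ¬P[x] }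
  ...   | no ¬P[] = none ¬P[]

  firstPrefix : ∀ {P : Pred (List A) p} (P? : Decidable P) xs →
    FirstPrefix P xs (find P? (inits xs))
  firstPrefix P? [] with P? []
  ... | yes P[] = some [] P[] ≡.refl λ { [] _ () ; (_ ∷ _) _ () }
  ... | no ¬P[] = none ¬P[]
  firstPrefix P? (x ∷ xs) with P? []
  ... | yes P[] = some (x ∷ xs) P[] ≡.refl λ { [] _ () ; (_ ∷ _) _ () }
  ... | no ¬P[]
    rewrite find-map P? (x ∷_) (inits xs)
    with find (P? ∘ (x ∷_)) (inits xs) | firstPrefix (P? ∘ (x ∷_)) xs
  ...   | just ws | some zs Pxws eq min = some zs Pxws (cong (x ∷_) eq)
            λ { [] _ ≡.refl → ¬P[] ; (_ ∷ vs) y ≡.refl → min vs y ≡.refl }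
  ...   | nothing | none ¬Pxs = none ¬Pxs

-- Totals, loads and the effect of migration.

module SchedulingProperties {c ℓ₁ ℓ₂} (𝔽 : OrderedField c ℓ₁ ℓ₂) where
  open OrderedField 𝔽
  open OrderedFieldProperties 𝔽
  open Scheduling 𝔽

  0≤size : ∀ {n} (js : Input n) i → 0# ≤ sizeAt js i
  0≤size js i = <⇒≤ (size-pos (lookup js i))

  total-++ : ∀ {n} (js : Input n) xs ys → total js (xs ++ ys) ≈ total js xs + total js ys
  total-++ js [] ys = sym (+-identityˡ _)
  total-++ js (x ∷ xs) ys = trans (+-congˡ (total-++ js xs ys)) (sym (+-assoc _ _ _))

  0≤total : ∀ {n} (js : Input n) xs → 0# ≤ total js xs
  0≤total js [] = ≤-refl
  0≤total js (x ∷ xs) = ≤-respˡ-≈ (+-identityʳ 0#) (0≤size js x ⊕ 0≤total js xs)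

  -- Surplus entries of `ys` have nonnegative size. Each entry of `xs` is cut out of `ys` once, and
  -- uniqueness of `xs` keeps its other entries inside what is left.
  total-mono-⊆ : ∀ {n} (js : Input n) {xs ys} → Unique xs → xs ⊆ ys → total js xs ≤ total js ys
  total-mono-⊆ js {[]} {ys} _ _ = 0≤total js ys
  total-mono-⊆ js {x ∷ xs} unq@(_ ∷ unq-xs) xs⊆ys with ∈-∃++ (xs⊆ys (here ≡.refl))
  ... | as , bs , ≡.refl =
    ≤-respʳ-≈ (sym middle) (≤-refl ⊕ total-mono-⊆ js unq-xs xs⊆as++bs)
    where
    xs⊆as++bs : xs ⊆ as ++ bs
    xs⊆as++bs i∈xs with ∈-++⁻ as (xs⊆ys (there i∈xs))
    ... | inj₁ i∈as              = ∈-++⁺ˡ i∈as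
    ... | inj₂ (here ≡.refl)     = contradiction i∈xs (Unique.Unique[x∷xs]⇒x∉xs unq)
    ... | inj₂ (there i∈bs)      = ∈-++⁺ʳ as i∈bs
    middle : total js (as ++ x ∷ bs) ≈ sizeAt js x + total js (as ++ bs)
    middle = trans (total-++ js as (x ∷ bs)) (trans
      (solve 3 (λ a x b → a :+ (x :+ b) := x :+ (a :+ b)) refl _ _ _)
      (+-congˡ (sym (total-++ js as bs))))

  total-cong-⊆⊇ : ∀ {n} (js : Input n) {xs ys} → Unique xs → Unique ys → xs ⊆ ys → ys ⊆ xs →
    total js xs ≈ total js ys
  total-cong-⊆⊇ js unq-xs unq-ys xs⊆ys ys⊆xs =
    antisym (total-mono-⊆ js unq-xs xs⊆ys) (total-mono-⊆ js unq-ys ys⊆xs)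

  total-map-suc : ∀ {n} (j : Job) (js : Input n) xs → total (j ∷ js) (map suc xs) ≈ total js xs
  total-map-suc j js []       = refl
  total-map-suc j js (x ∷ xs) = +-congˡ (total-map-suc j js xs)

  ∈-jobsOn⁺ : ∀ {n m} (σ : Schedule n) {i} → lookup σ i ≡ m → i ∈ jobsOn m σ
  ∈-jobsOn⁺ {m = m} σ {i} eq = ∈-filter⁺ (λ i → lookup σ i ≟ᵐ m) (∈-allFin i) eq

  ∈-jobsOn⁻ : ∀ {n m} (σ : Schedule n) {i} → i ∈ jobsOn m σ → lookup σ i ≡ m
  ∈-jobsOn⁻ {m = m} σ i∈ = proj₂ (∈-filter⁻ (λ i → lookup σ i ≟ᵐ m) {xs = allFin _} i∈)

  jobsOn-! : ∀ {n} m (σ : Schedule n) → Unique (jobsOn m σ)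
  jobsOn-! m σ = Unique.filter⁺ (λ i → lookup σ i ≟ᵐ m) (Unique.allFin⁺ _)

  0≤load : ∀ {n} (js : Input n) σ m → 0# ≤ load js σ m
  0≤load js σ m = 0≤total js (jobsOn m σ)

  map-suc-jobsOn-⊆ : ∀ {n} t m (σ : Schedule n) → map suc (jobsOn m σ) ⊆ jobsOn m (t ∷ σ)
  map-suc-jobsOn-⊆ t m σ i∈ with ∈-map⁻ suc i∈
  ... | i , i∈′ , ≡.refl = ∈-jobsOn⁺ (t ∷ σ) (∈-jobsOn⁻ σ i∈′)

  map-suc-jobsOn-! : ∀ {n} m (σ : Schedule n) → Unique (map suc (jobsOn m σ))
  map-suc-jobsOn-! m σ = Unique.map⁺ Fin.suc-injective (jobsOn-! m σ)

  load-∷-≡ : ∀ {n} (j : Job) (js : Input n) m σ →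
    load (j ∷ js) (m ∷ σ) m ≈ size j + load js σ m
  load-∷-≡ j js m σ = trans
    (total-cong-⊆⊇ (j ∷ js) (jobsOn-! m (m ∷ σ))
      (All.tabulate zero∉ ∷ map-suc-jobsOn-! m σ) sub sup)
    (+-congˡ (total-map-suc j js (jobsOn m σ)))
    where
    zero∉ : ∀ {i} → i ∈ map suc (jobsOn m σ) → zero ≢ i
    zero∉ i∈ ≡.refl with ∈-map⁻ suc i∈
    ... | _ , _ , ()
    sub : jobsOn m (m ∷ σ) ⊆ zero ∷ map suc (jobsOn m σ)
    sub {zero}  _  = here ≡.refl
    sub {suc i} i∈ = there (∈-map⁺ suc (∈-jobsOn⁺ σ (∈-jobsOn⁻ (m ∷ σ) i∈)))
    sup : zero ∷ map suc (jobsOn m σ) ⊆ jobsOn m (m ∷ σ)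
    sup (here ≡.refl) = ∈-jobsOn⁺ (m ∷ σ) ≡.refl
    sup (there i∈)    = map-suc-jobsOn-⊆ m m σ i∈

  load-∷-≢ : ∀ {n} (j : Job) (js : Input n) m t σ → t ≢ m →
    load (j ∷ js) (t ∷ σ) m ≈ load js σ m
  load-∷-≢ j js m t σ t≢m = trans
    (total-cong-⊆⊇ (j ∷ js) (jobsOn-! m (t ∷ σ)) (map-suc-jobsOn-! m σ) sub
      (map-suc-jobsOn-⊆ t m σ))
    (total-map-suc j js (jobsOn m σ))
    where
    sub : jobsOn m (t ∷ σ) ⊆ map suc (jobsOn m σ)
    sub {zero}  i∈ = contradiction (∈-jobsOn⁻ (t ∷ σ) i∈) t≢m
    sub {suc i} i∈ = ∈-map⁺ suc (∈-jobsOn⁺ σ (∈-jobsOn⁻ (t ∷ σ) i∈))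

  load-mono-∷ : ∀ {n} (j : Job) (js : Input n) t σ m → load js σ m ≤ load (j ∷ js) (t ∷ σ) m
  load-mono-∷ j js t σ m = ≤-respˡ-≈ (total-map-suc j js (jobsOn m σ))
    (total-mono-⊆ (j ∷ js) (map-suc-jobsOn-! m σ) (map-suc-jobsOn-⊆ t m σ))

  loads-total : ∀ {n} (js : Input n) σ → load js σ m₁ + load js σ m₂ ≈ total js (allFin n)
  loads-total js σ = trans (sym (total-++ js (jobsOn m₁ σ) (jobsOn m₂ σ)))
    (total-cong-⊆⊇ js
      (Unique.++⁺ (jobsOn-! m₁ σ) (jobsOn-! m₂ σ) disjoint) (Unique.allFin⁺ _)
      (λ {i} _ → ∈-allFin i) everywhere)
    where
    disjoint : ∀ {i} → ¬ (i ∈ jobsOn m₁ σ × i ∈ jobsOn m₂ σ)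
    disjoint (i∈₁ , i∈₂) with ≡.trans (≡.sym (∈-jobsOn⁻ σ i∈₁)) (∈-jobsOn⁻ σ i∈₂)
    ... | ()
    everywhere : allFin _ ⊆ jobsOn m₁ σ ++ jobsOn m₂ σ
    everywhere {i} _ with lookup σ i in eq
    ... | m₁ = ∈-++⁺ˡ (∈-jobsOn⁺ σ eq)
    ... | m₂ = ∈-++⁺ʳ (jobsOn m₁ σ) (∈-jobsOn⁺ σ eq)

  moveTo-m₁ : ∀ {n} → List (Fin n) → Schedule n → Schedule n
  moveTo-m₁ W σ = tabulate λ i → if does (i ∈? W) then m₁ else lookup σ i
    where open DecMembership Fin._≟_ using (_∈?_)

  lookup-moveTo-m₁ : ∀ {n} (W : List (Fin n)) σ i →
    (i ∈ W × lookup (moveTo-m₁ W σ) i ≡ m₁) ⊎ (i ∉ W × lookup (moveTo-m₁ W σ) i ≡ lookup σ i)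
  lookup-moveTo-m₁ W σ i
    rewrite lookup∘tabulate (λ i → if does (DecMembership._∈?_ Fin._≟_ i W) then m₁ else lookup σ i) i
    with DecMembership._∈?_ Fin._≟_ i W
  ... | yes i∈W = inj₁ (i∈W , ≡.refl)
  ... | no i∉W  = inj₂ (i∉W , ≡.refl)

  load-moveTo-m₁ : ∀ {n} (js : Input n) {W} σ → Unique W → W ⊆ jobsOn m₂ σ →
    load js (moveTo-m₁ W σ) m₂ + total js W ≈ load js σ m₂
  load-moveTo-m₁ js {W} σ unq-W W⊆Y = trans (sym (total-++ js (jobsOn m₂ σ′) W))
    (total-cong-⊆⊇ js (Unique.++⁺ (jobsOn-! m₂ σ′) unq-W disjoint) (jobsOn-! m₂ σ) sub sup)
    where
    σ′ = moveTo-m₁ W σ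
    disjoint : ∀ {i} → ¬ (i ∈ jobsOn m₂ σ′ × i ∈ W)
    disjoint {i} (i∈ , i∈W) with lookup-moveTo-m₁ W σ i
    ... | inj₂ (i∉W , _) = i∉W i∈W
    ... | inj₁ (_ , eq) with ≡.trans (≡.sym eq) (∈-jobsOn⁻ σ′ i∈)
    ...   | ()
    sub : jobsOn m₂ σ′ ++ W ⊆ jobsOn m₂ σ
    sub {i} i∈ with ∈-++⁻ (jobsOn m₂ σ′) i∈
    ... | inj₂ i∈W = W⊆Y i∈W
    ... | inj₁ i∈′ with lookup-moveTo-m₁ W σ i
    ...   | inj₁ (i∈W , _) = W⊆Y i∈W
    ...   | inj₂ (_ , eq)  = ∈-jobsOn⁺ σ (≡.trans (≡.sym eq) (∈-jobsOn⁻ σ′ i∈′))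
    sup : jobsOn m₂ σ ⊆ jobsOn m₂ σ′ ++ W
    sup {i} i∈ with lookup-moveTo-m₁ W σ i
    ... | inj₁ (i∈W , _) = ∈-++⁺ʳ (jobsOn m₂ σ′) i∈W
    ... | inj₂ (_ , eq)  = ∈-++⁺ˡ (∈-jobsOn⁺ σ′ (≡.trans eq (∈-jobsOn⁻ σ i∈)))

  migrated-m₁ : ∀ {n} (js : Input n) σ → total js (migrated σ (m₁ ∷ σ)) ≤ 0#
  migrated-m₁ js σ = total-mono-⊆ js {ys = []} (Unique.filter⁺ changed? (Unique.allFin⁺ _))
    λ i∈ → contradiction ≡.refl (proj₂ (∈-filter⁻ changed? {xs = allFin _} i∈))
    where changed? = λ i → ¬? (lookup σ i ≟ᵐ lookup σ i)

  migrated-m₂ : ∀ {n} (js : Input n) W σ →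
    total js (migrated σ (m₂ ∷ moveTo-m₁ W σ)) ≤ total js W
  migrated-m₂ js W σ = total-mono-⊆ js (Unique.filter⁺ changed? (Unique.allFin⁺ _)) sub
    where
    changed? = λ i → ¬? (lookup σ i ≟ᵐ lookup (moveTo-m₁ W σ) i)
    sub : filter changed? (allFin _) ⊆ W
    sub {i} i∈ with lookup-moveTo-m₁ W σ i
    ... | inj₁ (i∈W , _) = i∈W
    ... | inj₂ (_ , eq)  = contradiction (≡.sym eq) (proj₂ (∈-filter⁻ changed? {xs = allFin _} i∈))

-- Numerical consequences of the bounds on `M`.

module Analysis {c ℓ₁ ℓ₂} (𝔽 : OrderedField c ℓ₁ ℓ₂) where
  open OrderedField 𝔽
  open OrderedFieldProperties 𝔽
  open Scheduling 𝔽
  open SchedulingProperties 𝔽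
  open MinOp (Min.minOperator totalOrder) using (x⊓y≤x; x⊓y≤y; ⊓-sel)
  open MaxOp (Max.maxOperator totalOrder) using (x≤x⊔y; x≤y⊔x; ⊔-lub)

  ·1≉0 : ∀ n → ¬ (suc n · 1# ≈ 0#)
  ·1≉0 n eq = <⇒≱ 0<1 (scale⁻¹ n (≤-reflexive
    (trans (*-congʳ eq) (trans (zeroˡ 1#) (sym (zeroʳ (suc n · 1#)))))))

  y*[x/y]≈x : ∀ x y → ¬ (y ≈ 0#) → y * (x / y) ≈ x
  y*[x/y]≈x x y y≉0 = trans
    (solve 3 (λ x y y⁻¹ → y :* (x :* y⁻¹) := x :* (y :* y⁻¹)) refl x y (y ⁻¹))
    (trans (*-congˡ (*-inverseʳ y y≉0)) (*-identityʳ x))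

  module _ (sorter : Sorter) (M : Carrier) (2/3≤M : 2# / 3# ≤ M) (M<3/4 : M < 3# / 4#) where
    open AlgorithmD sorter M

    -- `U` is the target makespan and `T` the prefix threshold of step 5. The solver treats both as
    -- atoms, tied to `M` by `U+M≈2` and `3T≈M`.
    U T : Carrier
    U = 2# - M
    T = M / 3#

    2≤3M : 2# ≤ 3# * M
    2≤3M = ≤-respˡ-≈ (y*[x/y]≈x 2# 3# (·1≉0 2)) (scale 3 2/3≤M)

    4M<3 : 4# * M < 3#
    4M<3 = ≰⇒> λ 3≤4M → <⇒≱ M<3/4
      (scale⁻¹ 3 (≤-respˡ-≈ (sym (y*[x/y]≈x 3# 4# (·1≉0 3))) 3≤4M))

    3T≈M : 3# * T ≈ M
    3T≈M = y*[x/y]≈x M 3# (·1≉0 2)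

    U+M≈2 : U + M ≈ 2#
    U+M≈2 = y-x+x≈y 2# M

    2≤U+M : 2# ≤ U + M
    2≤U+M = ≤-reflexive (sym U+M≈2)

    0≤M : 0# ≤ M
    0≤M = scale⁻¹ 2 (linear-≤ (2≤3M ⊕ (0≤1 ⊕ 0≤1))
      (solve 1 (λ M → con 3 :* con 0 :+ (con 3 :* M :+ con 2)
                   := con 3 :* M :+ (con 2 :+ (con 0 :+ con 0))) refl M))

    M≤1 : M ≤ 1#
    M≤1 = scale⁻¹ 3 (linear-≤ (<⇒≤ 4M<3 ⊕ 0≤1)
      (solve 1 (λ M → con 4 :* M :+ con 4 := con 4 :* con 1 :+ (con 4 :* M :+ con 0)) refl M))

    1≤U : 1# ≤ U
    1≤U = linear-≤ (M≤1 ⊕ 2≤U+M)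
      (solve 2 (λ M U → con 1 :+ (con 1 :+ (U :+ M)) := U :+ (M :+ con 2)) refl M U)

    0≤T : 0# ≤ T
    0≤T = scale⁻¹ 2 (linear-≤ (0≤M ⊕ ≤-reflexive (sym 3T≈M))
      (solve 2 (λ M T → con 3 :* con 0 :+ (M :+ con 3 :* T)
                     := con 3 :* T :+ (con 0 :+ M)) refl M T))

    0<T : 0# < T
    0<T = ≰⇒> λ T≤0 → linear-⊥ (0<1 ⊕< 0≤1 ⊕ 2≤3M ⊕ scale 3 (≤-reflexive (sym 3T≈M)) ⊕ scale 9 T≤0)
      (solve 2 (λ M T → con 1 :+ (con 1 :+ con 3 :* M :+ con 3 :* (con 3 :* T) :+ con 9 :* con 0)
                     := con 0 :+ (con 0 :+ con 2 :+ con 3 :* M :+ con 9 :* T)) refl M T)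

    module _ {p y} (U<y+p : U < y + p) (y≤M : y ≤ M) where

      -- A job that does not fit next to `y ≤ M` has `p > U - y ≥ 2 - 2M`. This exceeds 1/2 by
      -- `M < 3/4`, whence `1≤2p` and `M≤2Mp`.
      2<p+2M : 2# < p + 2# * M
      2<p+2M = linear-< (U<y+p ⊕< y≤M ⊕ 2≤U+M)
        (solve 4 (λ M U p y → con 2 :+ ((y :+ p) :+ (M :+ (U :+ M)))
                           := (p :+ con 2 :* M) :+ (U :+ (y :+ con 2))) refl M U p y)

      1≤2p : 1# ≤ 2# * p
      1≤2p = linear-≤ (scale 2 (<⇒≤ 2<p+2M) ⊕ <⇒≤ 4M<3)
        (solve 2 (λ M p → con 1 :+ (con 2 :* (p :+ con 2 :* M) :+ con 3)
                       := con 2 :* p :+ (con 2 :* con 2 :+ con 4 :* M)) refl M p)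

      M≤2Mp : M ≤ 2# * (M * p)
      M≤2Mp = linear-≤ (*-rearrange 0≤M 1≤2p)
        (solve 2 (λ M p → M :+ (M :* (con 2 :* p) :+ con 0 :* con 1)
                       := con 2 :* (M :* p) :+ (con 0 :* (con 2 :* p) :+ M :* con 1)) refl M p)

    -- The sum `z + p` is at most `2M/3 + M = 5M/3`, which is below `2 - M` exactly when `M < 3/4`.
    z≤2T⇒z+p≤U : ∀ {z p} → z ≤ T + T → p ≤ M → U < z + p → ⊥
    z≤2T⇒z+p≤U {z} {p} z≤2T p≤M U<z+p = linear-⊥
      (4M<3 ⊕< 4M≤3 ⊕ scale 3 (<⇒≤ U<z+p) ⊕ scale 3 z≤2T ⊕ scale 3 p≤M
        ⊕ scale 3 2≤U+M ⊕ scale 2 (≤-reflexive 3T≈M))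
      (solve 5 (λ M U T p z →
        con 3 :+ (con 3 :+ con 3 :* (z :+ p) :+ con 3 :* (T :+ T) :+ con 3 :* M
          :+ con 3 :* (U :+ M) :+ con 2 :* M)
        := con 4 :* M :+ (con 4 :* M :+ con 3 :* U :+ con 3 :* z :+ con 3 :* p
          :+ con 3 :* con 2 :+ con 2 :* (con 3 :* T))) refl M U T p z)
      where 4M≤3 = <⇒≤ 4M<3

    -- Such jobs rule out p from their machine in every schedule of makespan at most 1.
    record Blocker {n} (js : Input n) (p : Carrier) (Y : List (Fin n)) : Set (c Level.⊔ ℓ₁ Level.⊔ ℓ₂) where
      field
        jobs     : List (Fin n)
        unique   : Unique jobs
        jobs⊆Y   : jobs ⊆ Y
        conflict : ∀ {i} → i ∈ jobs → 1# < p + sizeAt js i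
        p+1≤     : p + 1# ≤ total js jobs + U
        2M≤      : 2# * M ≤ total js jobs + 1#

    -- The common properties of the sets chosen in steps 4 and 5. By `fills`, accepting the job
    -- leaves at least `M` on `m₂`. The second premise of `blocker` is the rejection test
    -- `y - w + p > U`, rearranged.
    record GoodMigration {n} (js : Input n) (p : Carrier) (Y W : List (Fin n)) : Set (c Level.⊔ ℓ₁ Level.⊔ ℓ₂) where
      field
        unique  : Unique W
        W⊆Y     : W ⊆ Y
        cheap   : total js W ≤ M * p
        fills   : M + total js W ≤ total js Y + p
        blocker : p ≤ 1# → U + total js W < total js Y + p → Blocker js p Y

    Decreasing : ∀ {n} → Input n → List (Fin n) → Set ℓ₂
    Decreasing js = AllPairs (λ i k → sizeAt js k ≤ sizeAt js i)

    total-[x] : ∀ {n} (js : Input n) x → total js [ x ] ≈ sizeAt js x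
    total-[x] js x = +-identityʳ _

    -- The migration set of step 4.

    step₄-good : ∀ {n} (js : Input n) {p Y} → Unique Y → Decreasing js Y →
      total js Y ≤ M → M ≤ p → GoodMigration js p Y (step₄ js p Y)
    step₄-good js {p} {Y} unq dec y≤M M≤p
      with find (λ W → total js W ≤? M * p) (reverse (inits Y)) | lastPrefix (λ W → total js W ≤? M * p) Y
    ... | nothing | none 0≰Mp = contradiction (*-nonNeg 0≤M (≤-trans 0≤M M≤p)) 0≰Mp
    ... | just W | some R w≤Mp ≡.refl max = record
      { unique  = proj₁ (AllPairs-++⁻ W unq)
      ; W⊆Y     = ∈-++⁺ˡ
      ; cheap   = w≤Mp
      -- The new job alone brings `M`, since `W` is part of `Y`.
      ; fills   = ≤-respʳ-≈ (+-comm _ _)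
                    (M≤p ⊕ total-mono-⊆ js (proj₁ (AllPairs-++⁻ W unq)) ∈-++⁺ˡ)
      ; blocker = blocker R unq dec y≤M max
      }
      where
      w = total js W
      blocker : ∀ R → Unique (W ++ R) → Decreasing js (W ++ R) → total js (W ++ R) ≤ M →
        (∀ q qs → R ≡ q ∷ qs → ¬ total js (W ∷ʳ q) ≤ M * p) →
        p ≤ 1# → U + w < total js (W ++ R) + p → Blocker js p (W ++ R)
      -- Here `W` is all of `Y`, so the rejection test reads `p > U`, against `p ≤ 1 ≤ U`.
      blocker [] _ _ _ _ p≤1 U+w<y+p = contradiction 1≤U (<⇒≱ (linear-<
        (U+w<y+p ⊕< (≤-reflexive (total-++ js W []) ⊕ p≤1))
        (solve 4 (λ U w y p → U :+ ((y :+ p) :+ ((w :+ con 0) :+ con 1))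
                           := con 1 :+ ((U :+ w) :+ (y :+ p))) refl U w (total js (W ++ [])) p)))
      blocker (q ∷ R) unq dec y≤M max p≤1 U+w<y+p = record
        { jobs     = W ∷ʳ q
        ; unique   = proj₁ (AllPairs-++⁻ (W ∷ʳ q) (subst Unique assoc unq))
        ; jobs⊆Y   = λ i∈ → subst (_ ∈_) (≡.sym assoc) (∈-++⁺ˡ i∈)
        ; conflict = conflict
        -- From `a > M * p` and `(1 - p) * (1 - M) ≥ 0` follows `a > p + M - 1`.
        ; p+1≤     = linear-≤ (<⇒≤ Mp<a ⊕ *-rearrange p≤1 M≤1 ⊕ 2≤U+M)
            (solve 4 (λ M U p a → (p :+ con 1) :+ (a :+ (con 1 :* con 1 :+ p :* M) :+ (U :+ M))
              := (a :+ U) :+ (M :* p :+ (p :* con 1 :+ con 1 :* M) :+ con 2)) refl M U p a)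
        -- Here `a > M * p ≥ M²`, and `(1 - M)² ≥ 0` gives `M² ≥ 2M - 1`.
        ; 2M≤      = linear-≤ (<⇒≤ Mp<a ⊕ M²≤Mp ⊕ *-rearrange M≤1 M≤1)
            (solve 3 (λ M p a → con 2 :* M
                :+ (a :+ (M :* p :+ con 0 :* M) :+ (con 1 :* con 1 :+ M :* M))
              := (a :+ con 1) :+ (M :* p :+ (con 0 :* p :+ M :* M)
                :+ (M :* con 1 :+ con 1 :* M))) refl M p a)
        }
        where
        assoc : W ++ q ∷ R ≡ (W ∷ʳ q) ++ R
        assoc = ≡.sym (++-assoc W [ q ] R)
        a = total js (W ∷ʳ q)
        Mp<a : M * p < a
        Mp<a = ≰⇒> (max q R ≡.refl)
        M²≤Mp = *-rearrange 0≤M M≤p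
        smallest : ∀ {i} → i ∈ W ∷ʳ q → sizeAt js q ≤ sizeAt js i
        smallest i∈ with ∈-++⁻ W i∈
        ... | inj₁ i∈W = All.head (All.lookup (proj₂ (proj₂ (AllPairs-++⁻ W dec))) i∈W)
        ... | inj₂ (here ≡.refl) = ≤-refl
        -- It suffices to treat the smallest job `q`. As `w + q = a`, rejection gives
        -- `p + q > U + a - y`. By `y ≤ M` and `a > M²`, the right side exceeds
        -- `2 - 2M + M² = 1 + (1 - M)²`.
        conflict : ∀ {i} → i ∈ W ∷ʳ q → 1# < p + sizeAt js i
        conflict i∈ = linear-<
          (U+w<y+p ⊕< (y≤M ⊕ <⇒≤ Mp<a ⊕ ≤-reflexive (trans (total-++ js W [ q ]) (+-congˡ (total-[x] js q)))
            ⊕ M²≤Mp ⊕ *-rearrange M≤1 M≤1 ⊕ 2≤U+M ⊕ smallest i∈))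
          (solve 8 (λ M U p w y a q i → con 1 :+ ((y :+ p) :+ (M :+ a :+ (w :+ q)
              :+ (M :* p :+ con 0 :* M) :+ (con 1 :* con 1 :+ M :* M) :+ (U :+ M) :+ i))
            := (p :+ i) :+ ((U :+ w) :+ (y :+ M :* p :+ a
              :+ (con 0 :* p :+ M :* M) :+ (M :* con 1 :+ con 1 :* M) :+ con 2 :+ q)))
            refl M U p w (total js (W ++ q ∷ R)) a (sizeAt js q) (sizeAt js _))

    -- The migration set of step 5.

    data ShortestPrefix {n} (js : Input n) (Y W : List (Fin n)) : Set (c Level.⊔ ℓ₁ Level.⊔ ℓ₂) where
      shortest : ∀ R → W ++ R ≡ Y → T ≤ total js W →
        (∀ V x → V ∷ʳ x ≡ W → ¬ T ≤ total js V) → ShortestPrefix js Y W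

    -- The search succeeds: if all of `Y` had total below `T`, the job would fit on `m₂` by
    -- `z≤2T⇒z+p≤U`.
    shortestPrefix : ∀ {n} (js : Input n) {p Y} → p ≤ M → U < total js Y + p →
      ShortestPrefix js Y (shortestPrefixAtLeast js T Y)
    shortestPrefix js {p} {Y} p≤M U<y+p
      with find (λ W → T ≤? total js W) (inits Y) | firstPrefix (λ W → T ≤? total js W) Y
    ... | just W | some R T≤w eq min = shortest R eq T≤w min
    ... | nothing | none T≰y = contradiction U<y+p
          (z≤2T⇒z+p≤U (≤-respˡ-≈ (+-identityʳ _) (<⇒≤ (≰⇒> T≰y) ⊕ 0≤T)) p≤M)

    2M/3≈2T : (2# * M) / 3# ≈ T + T
    2M/3≈2T = solve 2 (λ M t → (con 2 :* M) :* t := M :* t :+ M :* t) refl M (3# ⁻¹)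

    ⊓<⇒<⊎< : ∀ {x y z} → x ⊓ y < z → x < z ⊎ y < z
    ⊓<⇒<⊎< {x} {y} lt with ⊓-sel x y
    ... | inj₁ eq = inj₁ (<-respˡ-≈ eq lt)
    ... | inj₂ eq = inj₂ (<-respˡ-≈ eq lt)

    module _ {p y} (U<y+p : U < y + p) (y≤M : y ≤ M) where

      -- `M + w ≤ 5M/3 ≤ 2 - M = U < y + p`, where the second inequality is `M < 3/4` again.
      w≤2T⇒fills : ∀ {w} → w ≤ T + T → M + w ≤ y + p
      w≤2T⇒fills {w} w≤2T = scale⁻¹ 2 (linear-≤
        (scale 3 (<⇒≤ U<y+p) ⊕ scale 3 w≤2T ⊕ scale 3 2≤U+M ⊕ scale 2 (<⇒≤ 4M<3)
          ⊕ scale 2 (≤-reflexive 3T≈M))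
        (solve 6 (λ M U T p y w → con 3 :* (M :+ w) :+ (con 3 :* (y :+ p)
            :+ con 3 :* (T :+ T) :+ con 3 :* (U :+ M) :+ con 2 :* con 3 :+ con 2 :* M)
          := con 3 :* (y :+ p) :+ (con 3 :* U :+ con 3 :* w :+ con 3 :* con 2
            :+ con 2 :* (con 4 :* M) :+ con 2 :* (con 3 :* T))) refl M U T p y w))

      module _ {w r} (y≈w+r : y ≈ w + r) where

        w+r≤y : w + r ≤ y
        w+r≤y = ≤-reflexive (sym y≈w+r)

        T≤w⇒r≤2T : T ≤ w → r ≤ T + T
        T≤w⇒r≤2T T≤w = linear-≤ (w+r≤y ⊕ y≤M ⊕ ≤-reflexive (sym 3T≈M) ⊕ T≤w)
          (solve 5 (λ M T y w r → r :+ (y :+ M :+ con 3 :* T :+ w)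
            := (T :+ T) :+ ((w :+ r) :+ y :+ M :+ T)) refl M T y w r)

        2T<w⇒r≤2T : T + T < w → r ≤ T + T
        2T<w⇒r≤2T 2T<w = T≤w⇒r≤2T
          (≤-trans (≤-respˡ-≈ (+-identityʳ T) (≤-refl ⊕ 0≤T)) (<⇒≤ 2T<w))

        -- Since `y ≤ M = 3T`, the remainder is below `T = M/3`, while `M * p ≥ M/2`.
        2T<w⇒r≤Mp : T + T < w → r ≤ M * p
        2T<w⇒r≤Mp 2T<w = scale⁻¹ 1 (linear-≤
          (scale 2 w+r≤y ⊕ scale 2 y≤M ⊕ scale 2 (<⇒≤ 2T<w) ⊕ ≤-reflexive (sym 3T≈M) ⊕ 0≤T
            ⊕ M≤2Mp U<y+p y≤M)
          (solve 6 (λ M T y w r q → con 2 :* r :+ (con 2 :* y :+ con 2 :* M :+ con 2 :* w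
              :+ con 3 :* T :+ T :+ con 2 :* q)
            := con 2 :* q :+ (con 2 :* (w :+ r) :+ con 2 :* y :+ con 2 :* (T :+ T)
              :+ M :+ con 0 :+ M)) refl M T y w r (M * p)))

        -- Here `r < M - M * p`, which is at most `M * p` because `p ≥ 1/2`.
        Mp<w⇒r≤Mp : M * p < w → r ≤ M * p
        Mp<w⇒r≤Mp Mp<w = linear-≤ (w+r≤y ⊕ y≤M ⊕ <⇒≤ Mp<w ⊕ M≤2Mp U<y+p y≤M)
          (solve 5 (λ M y w r q → r :+ (y :+ M :+ w :+ con 2 :* q)
            := q :+ ((w :+ r) :+ y :+ q :+ M)) refl M y w r (M * p))

        -- Here `r < M - M * p ≤ M/2`, so `M + r < 3M/2 ≤ 2 - M < y + p`. The middle inequality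
        -- amounts to `5M ≤ 4`, the sum of `4M ≤ 3` and `M ≤ 1`.
        Mp<w⇒fills : M * p < w → M + r ≤ y + p
        Mp<w⇒fills Mp<w = scale⁻¹ 1 (linear-≤
          (scale 2 (<⇒≤ U<y+p) ⊕ scale 2 y≤M ⊕ scale 2 w+r≤y ⊕ scale 2 (<⇒≤ Mp<w)
            ⊕ M≤2Mp U<y+p y≤M ⊕ scale 2 2≤U+M ⊕ <⇒≤ 4M<3 ⊕ M≤1)
          (solve 7 (λ M U p y w r q → con 2 :* (M :+ r) :+ (con 2 :* (y :+ p) :+ con 2 :* M
              :+ con 2 :* y :+ con 2 :* w :+ con 2 :* q :+ con 2 :* (U :+ M) :+ con 3 :+ con 1)
            := con 2 :* (y :+ p) :+ (con 2 :* U :+ con 2 :* y :+ con 2 :* (w :+ r)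
              :+ con 2 :* q :+ M :+ con 2 :* con 2 :+ con 4 :* M :+ M))
            refl M U p y w r (M * p)))

        U+w<y+p⇒U<r+p : U + w < y + p → U < r + p
        U+w<y+p⇒U<r+p lt = linear-< (lt ⊕< ≤-reflexive y≈w+r)
          (solve 5 (λ U p y w r → U :+ ((y :+ p) :+ (w :+ r))
            := (r :+ p) :+ ((U :+ w) :+ y)) refl U p y w r)

        U+r<y+p⇒U<w+p : U + r < y + p → U < w + p
        U+r<y+p⇒U<w+p lt = linear-< (lt ⊕< ≤-reflexive y≈w+r)
          (solve 5 (λ U p y w r → U :+ ((y :+ p) :+ (w :+ r))
            := (w :+ p) :+ ((U :+ r) :+ y)) refl U p y w r)

    singleton-blocker : ∀ {n} (js : Input n) {p Y} x → x ∈ Y → p ≤ M → U < total js [ x ] + p →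
      Blocker js p Y
    singleton-blocker js {p} x x∈Y p≤M U<q+p = record
      { jobs     = [ x ]
      ; unique   = [] ∷ []
      ; jobs⊆Y   = λ { (here ≡.refl) → x∈Y }
      ; conflict = λ { (here ≡.refl) → linear-<
          (U<q+p ⊕< (1≤U ⊕ ≤-reflexive (total-[x] js x)))
          (solve 4 (λ U p s t → con 1 :+ ((t :+ p) :+ (U :+ s))
            := (p :+ s) :+ (U :+ (con 1 :+ t))) refl U p (sizeAt js x) (total js [ x ])) }
      -- From `q > U - p` follows `q + U - p > 2U - 2p ≥ 4 - 4M ≥ 1`.
      ; p+1≤     = linear-≤ (<⇒≤ U<q+p ⊕ scale 2 p≤M ⊕ scale 2 2≤U+M ⊕ <⇒≤ 4M<3)
          (solve 4 (λ M U p q → (p :+ con 1) :+ ((q :+ p) :+ con 2 :* M :+ con 2 :* (U :+ M) :+ con 3)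
            := (q :+ U) :+ (U :+ con 2 :* p :+ con 2 :* con 2 :+ con 4 :* M)) refl M U p q)
      -- `q > U - p ≥ 2 - 2M ≥ 2M - 1`.
      ; 2M≤      = linear-≤ (<⇒≤ U<q+p ⊕ p≤M ⊕ 2≤U+M ⊕ <⇒≤ 4M<3)
          (solve 4 (λ M U p q → con 2 :* M :+ ((q :+ p) :+ M :+ (U :+ M) :+ con 3)
            := (q :+ con 1) :+ (U :+ p :+ con 2 :+ con 4 :* M)) refl M U p q)
      }
      where q = total js [ x ]

    -- The prefix must be a single job. It is nonempty as `T > 0`. With two or more jobs, minimality
    -- puts the total without the last one below `T`, and the last job, no larger than the first, is
    -- below `T` too. Then `w ≤ 2T` and `p` would fit beside `W`.
    prefix-blocker : ∀ {n} (js : Input n) {p} W R → Decreasing js (W ++ R) → T ≤ total js W →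
      (∀ V x → V ∷ʳ x ≡ W → ¬ T ≤ total js V) → p ≤ M → U < total js W + p →
      Blocker js p (W ++ R)
    prefix-blocker js W R dec T≤w min p≤M U<w+p with initLast W
    ... | []           = contradiction T≤w (<⇒≱ 0<T)
    ... | [] ∷ʳ′ x     = singleton-blocker js x (here ≡.refl) p≤M U<w+p
    ... | (v ∷ V) ∷ʳ′ x = contradiction U<w+p (z≤2T⇒z+p≤U w≤2T p≤M)
      where
      V<T : total js (v ∷ V) ≤ T
      V<T = <⇒≤ (≰⇒> (min (v ∷ V) x ≡.refl))
      x≤v : sizeAt js x ≤ sizeAt js v
      x≤v = All.head (All.lookup (proj₂ (proj₂ (AllPairs-++⁻ (v ∷ V)
        (proj₁ (AllPairs-++⁻ ((v ∷ V) ∷ʳ x) dec))))) (here ≡.refl))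
      v≤V : sizeAt js v ≤ total js (v ∷ V)
      v≤V = ≤-respˡ-≈ (+-identityʳ _) (≤-refl ⊕ 0≤total js V)
      w≤2T : total js ((v ∷ V) ∷ʳ x) ≤ T + T
      w≤2T = ≤-respˡ-≈ (sym (total-++ js (v ∷ V) [ x ]))
        (V<T ⊕ ≤-respˡ-≈ (sym (total-[x] js x)) (≤-trans x≤v (≤-trans v≤V V<T)))

    step₅-good : ∀ {n} (js : Input n) {p Y} → Unique Y → Decreasing js Y →
      total js Y ≤ M → p ≤ M → U < total js Y + p → GoodMigration js p Y (step₅ js p Y)
    step₅-good js {p} {Y} unq dec y≤M p≤M U<y+p
      with shortestPrefixAtLeast js T Y | shortestPrefix js {Y = Y} p≤M U<y+p
    ... | W | shortest R ≡.refl T≤w min with ((2# * M) / 3#) ⊓ (M * p) <? total js W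
    -- The prefix is kept. The remainder is at most `2T`, so it leaves room for `p` and rejection is
    -- impossible.
    ...   | no min≮w = record
      { unique  = proj₁ (AllPairs-++⁻ W unq)
      ; W⊆Y     = ∈-++⁺ˡ
      ; cheap   = ≤-trans (≮⇒≥ min≮w) (x⊓y≤y _ _)
      ; fills   = w≤2T⇒fills U<y+p y≤M
                    (≤-respʳ-≈ 2M/3≈2T (≤-trans (≮⇒≥ min≮w) (x⊓y≤x _ _)))
      ; blocker = λ _ U+w<y+p → contradiction
          (U+w<y+p⇒U<r+p U<y+p y≤M (total-++ js W R) U+w<y+p)
          (z≤2T⇒z+p≤U (T≤w⇒r≤2T U<y+p y≤M (total-++ js W R) T≤w) p≤M)
      }
    -- The remainder is migrated instead. Rejection now means that `p` does not fit beside the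
    -- prefix, which `prefix-blocker` turns into one large job.
    ...   | yes min<w rewrite filter-∉-++ W R unq = record
      { unique  = proj₁ (proj₂ (AllPairs-++⁻ W unq))
      ; W⊆Y     = ∈-++⁺ʳ W
      ; cheap   = proj₁ replacement
      ; fills   = proj₂ replacement
      ; blocker = λ _ U+r<y+p → prefix-blocker js W R dec T≤w min p≤M
          (U+r<y+p⇒U<w+p U<y+p y≤M y≈w+r U+r<y+p)
      }
      where
      y≈w+r = total-++ js W R
      replacement : total js R ≤ M * p × M + total js R ≤ total js (W ++ R) + p
      replacement with ⊓<⇒<⊎< min<w
      ... | inj₁ 2M/3<w = 2T<w⇒r≤Mp U<y+p y≤M y≈w+r 2T<w ,
                          w≤2T⇒fills U<y+p y≤M (2T<w⇒r≤2T U<y+p y≤M y≈w+r 2T<w)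
        where 2T<w = <-respˡ-≈ 2M/3≈2T 2M/3<w
      ... | inj₂ Mp<w   = Mp<w⇒r≤Mp U<y+p y≤M y≈w+r Mp<w ,
                          Mp<w⇒fills U<y+p y≤M y≈w+r Mp<w

    -- What each decision guarantees, independently of offline schedules.

    data Outcome {n} (j : Job) (js : Input n) (σ : Schedule n) : Decision n → Set (c Level.⊔ ℓ₁ Level.⊔ ℓ₂) where
      forced  : gos j ≡ gos₁ ⊎ M ≤ load js σ m₂ → Outcome j js σ assignTo-m₁
      accepts : ∀ {W} → gos j ≡ gos₂ → Unique W → W ⊆ jobsOn m₂ σ → total js W ≤ M * size j →
        -- The left alternative is step 3, after which `m₂` may still be below `M`; steps 4 and 5
        -- give the right one.
        W ≡ [] ⊎ M + total js W ≤ load js σ m₂ + size j →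
        load js σ m₂ + size j ≤ U + total js W → Outcome j js σ (migrate W assignTo-m₂)
      -- `size j ≤ 1#` is a premise because outcomes are derived for arbitrary inputs; a schedule of
      -- makespan at most 1 supplies it later.
      rejects : gos j ≡ gos₂ → load js σ m₂ < M → 2# < size j + 2# * M →
        (size j ≤ 1# → Blocker js (size j) (jobsOn m₂ σ)) → Outcome j js σ assignTo-m₁

    module _ {n} (j : Job) (js : Input n) (σ : Schedule n) where
      private
        p = size j
        y = load js σ m₂
        Y↓ = SortingAlgorithm.sort (sorter js) (jobsOn m₂ σ)
        Y↓↭Y = SortingAlgorithm.sort-↭ (sorter js) (jobsOn m₂ σ)

      Y↓⊆Y : Y↓ ⊆ jobsOn m₂ σ
      Y↓⊆Y = ∈-resp-↭ Y↓↭Y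

      Y↓-! : Unique Y↓
      Y↓-! = Permutationₛ.Unique-resp-↭ (≡.setoid _) (↭⇒↭ₛ (↭-sym Y↓↭Y)) (jobsOn-! m₂ σ)

      Y↓-decreasing : Decreasing js Y↓
      Y↓-decreasing = Sorted⇒AllPairs (byDecreasingSize js)
        (SortingAlgorithm.sort-↗ (sorter js) (jobsOn m₂ σ))

      total-Y↓ : total js Y↓ ≈ y
      total-Y↓ = total-cong-⊆⊇ js Y↓-! (jobsOn-! m₂ σ) Y↓⊆Y (∈-resp-↭ (↭-sym Y↓↭Y))

      tryMigrating-outcome : gos j ≡ gos₂ → y < M → U < y + p →
        ∀ W → GoodMigration js p Y↓ W →
        Outcome j js σ (if does (U <? (y - total js W) + p) then assignTo-m₁ else migrate W assignTo-m₂)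
      tryMigrating-outcome gos≡ y<M U<y+p W good with U <? (y - total js W) + p
      ... | no U≮ = accepts gos≡ unique (λ i∈W → Y↓⊆Y (W⊆Y i∈W)) cheap
            (inj₂ (≤-respʳ-≈ (+-congʳ total-Y↓) fills))
            (linear-≤ (≮⇒≥ U≮ ⊕ ≤-reflexive (sym (y-x+x≈y y (total js W))))
              (solve 5 (λ U p y w r → (y :+ p) :+ (U :+ (r :+ w)) := (U :+ w) :+ ((r :+ p) :+ y))
                refl U p y (total js W) (y - total js W)))
        where open GoodMigration good
      ... | yes U< = rejects gos≡ y<M (2<p+2M U<y+p (<⇒≤ y<M)) λ p≤1 →
            let open Blocker (blocker p≤1 U+w<y+p) in record
              { jobs = jobs ; unique = unique ; jobs⊆Y = λ i∈ → Y↓⊆Y (jobs⊆Y i∈)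
              ; conflict = conflict ; p+1≤ = p+1≤ ; 2M≤ = 2M≤ }
        where
        open GoodMigration good using (blocker)
        U+w<y+p : U + total js W < total js Y↓ + p
        U+w<y+p = <-respʳ-≈ (+-congʳ (sym total-Y↓))
          (linear-< (U< ⊕< ≤-reflexive (y-x+x≈y y (total js W)))
            (solve 5 (λ U p y w r → (U :+ w) :+ ((r :+ p) :+ y) := (y :+ p) :+ (U :+ (r :+ w)))
              refl U p y (total js W) (y - total js W)))

      outcome : Outcome j js σ (decide j js σ)
      outcome with gos j in gos≡
      ... | gos₁ = forced (inj₁ gos≡)
      ... | gos₂ with M ≤? y
      ...   | yes M≤y = forced (inj₂ M≤y)
      ...   | no M≰y with y + p ≤? U
      ...     | yes y+p≤U = accepts gos≡ [] (λ ()) (*-nonNeg 0≤M (<⇒≤ (size-pos j))) (inj₁ ≡.refl)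
                  (≤-respʳ-≈ (sym (+-identityʳ U)) y+p≤U)
      ...     | no y+p≰U with M ≤? p
      ...       | yes M≤p = tryMigrating-outcome gos≡ (≰⇒> M≰y) (≰⇒> y+p≰U) _
                    (step₄-good js Y↓-! Y↓-decreasing (≤-respˡ-≈ (sym total-Y↓) (<⇒≤ (≰⇒> M≰y))) M≤p)
      ...       | no M≰p = tryMigrating-outcome gos≡ (≰⇒> M≰y) (≰⇒> y+p≰U) _
                    (step₅-good js Y↓-! Y↓-decreasing (≤-respˡ-≈ (sym total-Y↓) (<⇒≤ (≰⇒> M≰y)))
                      (<⇒≤ (≰⇒> M≰p)) (<-respʳ-≈ (+-congʳ (sym total-Y↓)) (≰⇒> y+p≰U)))

    mayRunOn-m₁ : ∀ g → g mayRunOn m₁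
    mayRunOn-m₁ gos₁ = gos₁-m₁
    mayRunOn-m₁ gos₂ = gos₂-m₁

    respectsGoS : RespectsGoS algorithmD
    respectsGoS (j ∷ js) with decide j js (algorithmD js) | outcome j js (algorithmD js) | respectsGoS js
    ... | _ | forced _        | feasible = λ { zero → mayRunOn-m₁ (gos j) ; (suc i) → feasible i }
    ... | _ | rejects _ _ _ _ | feasible = λ { zero → mayRunOn-m₁ (gos j) ; (suc i) → feasible i }
    ... | migrate W assignTo-m₂ | accepts gos≡ _ _ _ _ _ | feasible = λ
      { zero → subst (_mayRunOn m₂) (≡.sym gos≡) gos₂-m₂
      ; (suc i) → moved i (lookup-moveTo-m₁ W (algorithmD js) i) }
      where
      moved : ∀ i → _ → gos (lookup js i) mayRunOn lookup (moveTo-m₁ W (algorithmD js)) i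
      moved i (inj₁ (_ , eq)) = subst (gos (lookup js i) mayRunOn_) (≡.sym eq) (mayRunOn-m₁ _)
      moved i (inj₂ (_ , eq)) = subst (gos (lookup js i) mayRunOn_) (≡.sym eq) (feasible i)

    migrationFactor : MigrationFactorAtMost algorithmD M
    migrationFactor j js with decide j js (algorithmD js) | outcome j js (algorithmD js)
    ... | _ | forced _ = ≤-trans (migrated-m₁ js (algorithmD js)) (*-nonNeg 0≤M (<⇒≤ (size-pos j)))
    ... | _ | rejects _ _ _ _ = ≤-trans (migrated-m₁ js (algorithmD js)) (*-nonNeg 0≤M (<⇒≤ (size-pos j)))
    ... | migrate W assignTo-m₂ | accepts _ _ _ w≤Mp _ _ =
      ≤-trans (migrated-m₂ js W (algorithmD js)) w≤Mp

    load-accept : ∀ {n} (j : Job) (js : Input n) {W} σ → Unique W → W ⊆ jobsOn m₂ σ →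
      load (j ∷ js) (m₂ ∷ moveTo-m₁ W σ) m₂ + total js W ≈ load js σ m₂ + size j
    load-accept j js {W} σ unq W⊆Y = trans (+-congʳ (load-∷-≡ j js m₂ (moveTo-m₁ W σ)))
      (trans (solve 3 (λ p y′ w → (p :+ y′) :+ w := (y′ :+ w) :+ p) refl _ _ _)
        (+-congʳ (load-moveTo-m₁ js σ unq W⊆Y)))

    -- Only acceptances add to `m₂`, and each has passed a test against `U`.
    load-m₂≤U : ∀ {n} (js : Input n) → load js (algorithmD js) m₂ ≤ U
    load-m₂≤U [] = ≤-trans 0≤1 1≤U
    load-m₂≤U (j ∷ js) with decide j js (algorithmD js) | outcome j js (algorithmD js) | load-m₂≤U js
    ... | _ | forced _        | y≤U = ≤-respˡ-≈ (sym (load-∷-≢ j js m₂ m₁ (algorithmD js) λ ())) y≤U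
    ... | _ | rejects _ _ _ _ | y≤U = ≤-respˡ-≈ (sym (load-∷-≢ j js m₂ m₁ (algorithmD js) λ ())) y≤U
    ... | migrate W assignTo-m₂ | accepts _ unq W⊆Y _ _ y+p≤U+w | _ = +-cancelʳ-≤ (total js W)
      (≤-respˡ-≈ (sym (load-accept j js (algorithmD js) unq W⊆Y)) y+p≤U+w)

    -- Comparison with an offline schedule.

    -- In the case blocked a GoS-2 job has been rejected; the bounds on the loads of τ
    -- leave no room for a second one.
    data Invariant {n} (js : Input n) (τ σ : Schedule n) : Set (c Level.⊔ ℓ₁ Level.⊔ ℓ₂) where
      full     : M ≤ load js σ m₂ → Invariant js τ σ
      allOn-m₂ : (∀ i → gos (lookup js i) ≡ gos₂ → lookup σ i ≡ m₂) → Invariant js τ σ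
      blocked  : load js σ m₁ + 1# ≤ load js τ m₁ + U →
        (∀ m → 2# * M ≤ load js τ m + 1#) → Invariant js τ σ

    Fits : ∀ {n} → Input n → Schedule n → Set ℓ₂
    Fits js τ = ∀ m → load js τ m ≤ 1#

    gos₁⇒m₁ : ∀ {g m} → g mayRunOn m → g ≡ gos₁ → m ≡ m₁
    gos₁⇒m₁ gos₁-m₁ _ = ≡.refl

    ≢-≢⇒≡ : ∀ {a m t : Machine} → a ≢ t → m ≢ t → a ≡ m
    ≢-≢⇒≡ {m₁} {m₁}      _   _   = ≡.refl
    ≢-≢⇒≡ {m₂} {m₂}      _   _   = ≡.refl
    ≢-≢⇒≡ {m₁} {m₂} {m₁} a≢t _   = contradiction ≡.refl a≢t
    ≢-≢⇒≡ {m₁} {m₂} {m₂} _   m≢t = contradiction ≡.refl m≢t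
    ≢-≢⇒≡ {m₂} {m₁} {m₁} _   m≢t = contradiction ≡.refl m≢t
    ≢-≢⇒≡ {m₂} {m₁} {m₂} a≢t _   = contradiction ≡.refl a≢t

    module _ {n} (js : Input n) (σ τ : Schedule n) (τ-feasible : Feasible js τ)
      (allOn : ∀ i → gos (lookup js i) ≡ gos₂ → lookup σ i ≡ m₂) where

      on-m₁⇒gos₁ : ∀ {i} → lookup σ i ≡ m₁ → gos (lookup js i) ≡ gos₁
      on-m₁⇒gos₁ {i} on-m₁ with gos (lookup js i) in gos≡
      ... | gos₁ = ≡.refl
      ... | gos₂ with ≡.trans (≡.sym on-m₁) (allOn i gos≡)
      ...   | ()

      -- All jobs on `m₁` in `σ` have GoS 1, so feasibility puts them on `m₁` in `τ` as well. The
      -- jobs `A` come on top, since `σ` has them on `m₂`.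
      load-m₁+total≤ : ∀ {A} → Unique A → A ⊆ jobsOn m₂ σ → (∀ {i} → i ∈ A → lookup τ i ≡ m₁) →
        load js σ m₁ + total js A ≤ load js τ m₁
      load-m₁+total≤ {A} unq A⊆Y A-on-m₁ = ≤-respˡ-≈ (total-++ js (jobsOn m₁ σ) A)
        (total-mono-⊆ js (Unique.++⁺ (jobsOn-! m₁ σ) unq disjoint) sub)
        where
        disjoint : ∀ {i} → ¬ (i ∈ jobsOn m₁ σ × i ∈ A)
        disjoint (i∈₁ , i∈A) with ≡.trans (≡.sym (∈-jobsOn⁻ σ i∈₁)) (∈-jobsOn⁻ σ (A⊆Y i∈A))
        ... | ()
        sub : jobsOn m₁ σ ++ A ⊆ jobsOn m₁ τ
        sub {i} i∈ with ∈-++⁻ (jobsOn m₁ σ) i∈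
        ... | inj₁ i∈₁ = ∈-jobsOn⁺ τ (gos₁⇒m₁ (τ-feasible i) (on-m₁⇒gos₁ (∈-jobsOn⁻ σ i∈₁)))
        ... | inj₂ i∈A = ∈-jobsOn⁺ τ (A-on-m₁ i∈A)

      load-m₁≤ : load js σ m₁ ≤ load js τ m₁
      load-m₁≤ = ≤-respˡ-≈ (+-identityʳ _) (load-m₁+total≤ [] (λ ()) λ ())

    sizes-on-same≤ : ∀ {n} (j : Job) (js : Input n) t τ {i} → lookup τ i ≡ t →
      size j + sizeAt js i ≤ load (j ∷ js) (t ∷ τ) t
    sizes-on-same≤ j js t τ on-t = ≤-respʳ-≈ (sym (load-∷-≡ j js t τ)) (≤-refl ⊕
      ≤-respˡ-≈ (+-identityʳ _) (total-mono-⊆ js {xs = _ ∷ []} ([] ∷ [])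
        λ { (here ≡.refl) → ∈-jobsOn⁺ τ on-t }))

    size≤load : ∀ {n} (j : Job) (js : Input n) t τ → size j ≤ load (j ∷ js) (t ∷ τ) t
    size≤load j js t τ = ≤-respʳ-≈ (sym (load-∷-≡ j js t τ))
      (≤-respˡ-≈ (+-identityʳ _) (≤-refl ⊕ 0≤load js τ t))

    -- By `conflict`, no blocking job shares the machine `t` with the rejected job in `τ`, so all of
    -- them lie on the other machine.
    blocked-by : ∀ {n} (j : Job) (js : Input n) σ t τ → Feasible js τ → Fits (j ∷ js) (t ∷ τ) →
      (∀ i → gos (lookup js i) ≡ gos₂ → lookup σ i ≡ m₂) →
      2# < size j + 2# * M → Blocker js (size j) (jobsOn m₂ σ) →
      Invariant (j ∷ js) (t ∷ τ) (m₁ ∷ σ)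
    blocked-by j js σ t τ τ-feasible fits allOn 2<p+2M blk = blocked (load-m₁≤load t not-on-t) 2M≤load
      where
      open Blocker blk
      p = size j
      a = total js jobs

      not-on-t : ∀ {i} → i ∈ jobs → lookup τ i ≢ t
      not-on-t i∈ on-t = <⇒≱ (conflict i∈) (≤-trans (sizes-on-same≤ j js t τ on-t) (fits t))

      2M≤load : ∀ m → 2# * M ≤ load (j ∷ js) (t ∷ τ) m + 1#
      2M≤load m with m ≟ᵐ t
      -- The rejected job suffices here: `p > 2 - 2M ≥ 2M - 1`.
      ... | yes ≡.refl = linear-≤ (<⇒≤ 2<p+2M ⊕ <⇒≤ 4M<3 ⊕ size≤load j js t τ)
        (solve 3 (λ M p u → con 2 :* M :+ ((p :+ con 2 :* M) :+ con 3 :+ u)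
          := (u :+ con 1) :+ (con 2 :+ con 4 :* M :+ p)) refl M p _)
      ... | no m≢t = ≤-trans 2M≤ (≤-trans
        (total-mono-⊆ js unique λ i∈ → ∈-jobsOn⁺ τ (≢-≢⇒≡ (not-on-t i∈) m≢t))
        (load-mono-∷ j js t τ m) ⊕ ≤-refl)

      load-m₁≤load : ∀ t → (∀ {i} → i ∈ jobs → lookup τ i ≢ t) →
        load (j ∷ js) (m₁ ∷ σ) m₁ + 1# ≤ load (j ∷ js) (t ∷ τ) m₁ + U
      -- Both schedules put `p` on `m₁`, so `σ` has no excess over `τ` there, and `0 ≤ U - 1`.
      load-m₁≤load m₁ _ = linear-≤ (load-m₁≤ js σ τ τ-feasible allOn ⊕ 1≤U
          ⊕ ≤-reflexive (load-∷-≡ j js m₁ σ) ⊕ ≤-reflexive (sym (load-∷-≡ j js m₁ τ)))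
        (solve 6 (λ U p s s′ u u′ → (s′ :+ con 1) :+ (u :+ U :+ (p :+ s) :+ u′)
            := (u′ :+ U) :+ (s :+ con 1 :+ s′ :+ (p :+ u))) refl
          U p (load js σ m₁) _ (load js τ m₁) _)
      -- Now `τ` has the blocking jobs on `m₁` in place of `p`. The excess is at most `p - a`, which
      -- `p+1≤` bounds by `U - 1`.
      load-m₁≤load m₂ not-on-m₂ = linear-≤
        (load-m₁+total≤ js σ τ τ-feasible allOn unique jobs⊆Y (λ i∈ → ≢-≢⇒≡ (not-on-m₂ i∈) λ ())
          ⊕ p+1≤ ⊕ ≤-reflexive (load-∷-≡ j js m₁ σ) ⊕ load-mono-∷ j js m₂ τ m₁)
        (solve 7 (λ U p a s s′ u u′ →
            (s′ :+ con 1) :+ (u :+ (a :+ U) :+ (p :+ s) :+ u′)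
            := (u′ :+ U) :+ ((s :+ a) :+ (p :+ con 1) :+ s′ :+ u)) refl
          U p a (load js σ m₁) _ (load js τ m₁) _)

    -- By `growth`, the arrival adds no more to `m₁` in the algorithm's schedule than in `τ`, so the
    -- excess does not increase.
    blocked-step : ∀ {n} (j : Job) (js : Input n) σ σ′ t τ →
      load (j ∷ js) σ′ m₁ + load js τ m₁ ≤ load js σ m₁ + load (j ∷ js) (t ∷ τ) m₁ →
      load js σ m₁ + 1# ≤ load js τ m₁ + U → (∀ m → 2# * M ≤ load js τ m + 1#) →
      Invariant (j ∷ js) (t ∷ τ) σ′
    blocked-step j js σ σ′ t τ growth σ₁≤ 2M≤ = blocked
      (linear-≤ (growth ⊕ σ₁≤)
        (solve 5 (λ U s s′ u u′ → (s′ :+ con 1) :+ ((s :+ u′) :+ (u :+ U))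
            := (u′ :+ U) :+ ((s′ :+ u) :+ (s :+ con 1))) refl
          U (load js σ m₁) _ (load js τ m₁) _))
      (λ m → ≤-trans (2M≤ m) (load-mono-∷ j js t τ m ⊕ ≤-refl))

    moveTo-m₁-[] : ∀ {n} (σ : Schedule n) → moveTo-m₁ [] σ ≡ σ
    moveTo-m₁-[] = tabulate∘lookup

    step : ∀ {n} (j : Job) (js : Input n) σ {d} t τ → Outcome j js σ d →
      Feasible (j ∷ js) (t ∷ τ) → Fits (j ∷ js) (t ∷ τ) →
      Invariant js τ σ → Invariant (j ∷ js) (t ∷ τ) (execute d σ)
    step j js σ t τ (forced (inj₂ M≤y)) _ _ _ = full (≤-trans M≤y (load-mono-∷ j js m₁ σ m₂))
    step j js σ t τ (forced (inj₁ gos≡)) feasible fits inv with inv | gos₁⇒m₁ (feasible zero) gos≡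
    ... | full M≤y | _ = full (≤-trans M≤y (load-mono-∷ j js m₁ σ m₂))
    ... | allOn-m₂ allOn | _ = allOn-m₂ λ
      { zero gos₂≡ → contradiction (≡.trans (≡.sym gos≡) gos₂≡) λ ()
      ; (suc i) → allOn i }
    ... | blocked σ₁≤ 2M≤ | ≡.refl = blocked-step j js σ (m₁ ∷ σ) m₁ τ
      (linear-≤ (≤-reflexive (load-∷-≡ j js m₁ σ) ⊕ ≤-reflexive (sym (load-∷-≡ j js m₁ τ)))
        (solve 5 (λ p s s′ u u′ → (s′ :+ u) :+ ((p :+ s) :+ u′)
          := (s :+ u′) :+ (s′ :+ (p :+ u))) refl (size j) (load js σ m₁) _ (load js τ m₁) _))
      σ₁≤ 2M≤
    step j js σ t τ (accepts {W} _ unq W⊆Y _ (inj₂ M+w≤y+p) _) _ _ _ =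
      full (+-cancelʳ-≤ (total js W) (≤-respʳ-≈ (sym (load-accept j js σ unq W⊆Y)) M+w≤y+p))
    step j js σ t τ (accepts _ _ _ _ (inj₁ ≡.refl) _) _ _ inv rewrite moveTo-m₁-[] σ with inv
    ... | full M≤y = full (≤-trans M≤y (load-mono-∷ j js m₂ σ m₂))
    ... | allOn-m₂ allOn = allOn-m₂ λ { zero _ → ≡.refl ; (suc i) → allOn i }
    ... | blocked σ₁≤ 2M≤ = blocked-step j js σ (m₂ ∷ σ) t τ
      (≤-reflexive (load-∷-≢ j js m₁ m₂ σ λ ()) ⊕ load-mono-∷ j js t τ m₁) σ₁≤ 2M≤
    step j js σ t τ (rejects _ y<M 2<p+2M blk) feasible fits inv with inv
    ... | full M≤y = contradiction M≤y (<⇒≱ y<M)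
    ... | allOn-m₂ allOn = blocked-by j js σ t τ (λ i → feasible (suc i)) fits allOn 2<p+2M
      (blk (≤-trans (size≤load j js t τ) (fits t)))
    -- A second rejected job would give its machine in `τ` a load of at least `(2M - 1) + p > 1`.
    ... | blocked _ 2M≤ = contradiction (fits t) (<⇒≱ (linear-<
      (2<p+2M ⊕< (2M≤ t ⊕ ≤-reflexive (sym (load-∷-≡ j js t τ))))
      (solve 4 (λ M p u u′ → con 1 :+ ((p :+ con 2 :* M) :+ ((u :+ con 1) :+ u′))
        := u′ :+ (con 2 :+ (con 2 :* M :+ (p :+ u)))) refl M (size j) (load js τ t) _)))

    -- One schedule of the complete input serves for all arrivals: its tails stay feasible and fit,
    -- since dropping the newest job lowers loads. Optimality would not pass to tails, hence the
    -- hypothesis `Fits`.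
    invariant : ∀ {n} (js : Input n) τ → Feasible js τ → Fits js τ → Invariant js τ (algorithmD js)
    invariant [] [] _ _ = allOn-m₂ λ ()
    invariant (j ∷ js) (t ∷ τ) feasible fits =
      step j js (algorithmD js) t τ (outcome j js (algorithmD js)) feasible fits
        (invariant js τ (λ i → feasible (suc i)) λ m → ≤-trans (load-mono-∷ j js t τ m) (fits m))

    load-m₁≤U : ∀ {n} (js : Input n) τ → Feasible js τ → Fits js τ → load js (algorithmD js) m₁ ≤ U
    load-m₁≤U js τ feasible fits with invariant js τ feasible fits
    ... | allOn-m₂ allOn =
      ≤-trans (load-m₁≤ js (algorithmD js) τ feasible allOn) (≤-trans (fits m₁) 1≤U)
    ... | blocked σ₁≤ _ = linear-≤ (σ₁≤ ⊕ fits m₁)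
      (solve 3 (λ U s u → s :+ ((u :+ U) :+ con 1) := U :+ ((s :+ con 1) :+ u)) refl
        U (load js (algorithmD js) m₁) (load js τ m₁))
    -- `τ` shows that the total size is at most 2, of which `m₂` already holds `M`.
    ... | full M≤y = linear-≤
      (M≤y ⊕ ≤-reflexive (trans (loads-total js (algorithmD js)) (sym (loads-total js τ)))
        ⊕ fits m₁ ⊕ fits m₂ ⊕ 2≤U+M)
      (solve 6 (λ M U s y u v → s :+ (y :+ (u :+ v) :+ con 1 :+ con 1 :+ (U :+ M))
        := U :+ (M :+ (s :+ y) :+ u :+ v :+ con 2)) refl
        M U (load js (algorithmD js) m₁) (load js (algorithmD js) m₂) (load js τ m₁) (load js τ m₂))

    makespan≤U : ∀ {n} (js : Input n) {opt} → IsOptimalMakespan js opt → opt ≈ 1# →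
      makespan js (algorithmD js) ≤ U
    makespan≤U js ((τ , feasible , makespan≈opt) , _) opt≈1 =
      ⊔-lub (load-m₁≤U js τ feasible fits) (load-m₂≤U js)
      where
      makespan≤1 : makespan js τ ≤ 1#
      makespan≤1 = ≤-reflexive (trans makespan≈opt opt≈1)
      fits : Fits js τ
      fits m₁ = ≤-trans (x≤x⊔y _ _) makespan≤1
      fits m₂ = ≤-trans (x≤y⊔x _ _) makespan≤1

    x/y≈x : ∀ x {y} → y ≈ 1# → x / y ≈ x
    x/y≈x x {y} y≈1 = trans (*-congˡ y⁻¹≈1) (*-identityʳ x)
      where
      y≉0 : ¬ (y ≈ 0#)
      y≉0 y≈0 = 0#≉1# (trans (sym y≈0) y≈1)
      -- `_⁻¹` is not assumed to respect `_≈_`, so its value at `y` is computed from the inverse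
      -- law.
      y⁻¹≈1 : y ⁻¹ ≈ 1#
      y⁻¹≈1 = trans (sym (*-identityˡ (y ⁻¹))) (trans (*-congʳ (sym y≈1)) (*-inverseʳ y y≉0))

    competitiveRatio : CompetitiveRatioAtMost algorithmD U
    competitiveRatio js opt optimal opt≈1 =
      ≤-respˡ-≈ (sym (x/y≈x _ opt≈1)) (makespan≤U js optimal opt≈1)

mainTheorem13 :
    ∀ {c ℓ₁ ℓ₂} (𝔽 : OrderedField c ℓ₁ ℓ₂) →
    let open OrderedField 𝔽
        open Scheduling 𝔽 in
    (sorter : Sorter) (M : Carrier) → 2# / 3# ≤ M → M < 3# / 4# →
    let open AlgorithmD sorter M in
    RespectsGoS algorithmD ×
    MigrationFactorAtMost algorithmD M ×
    (∀ {n} (js : Input n) → IsOptimalMakespan js 1# →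
      makespan js (algorithmD js) ≤ 2# - M) ×
    CompetitiveRatioAtMost algorithmD (2# - M)
mainTheorem13 𝔽 sorter M 2/3≤M M<3/4 =
  respectsGoS sorter M 2/3≤M M<3/4 ,
  migrationFactor sorter M 2/3≤M M<3/4 ,
  (λ js optimal → makespan≤U sorter M 2/3≤M M<3/4 js optimal refl) ,
  competitiveRatio sorter M 2/3≤M M<3/4
  where
  open Analysis 𝔽
  open OrderedFieldProperties 𝔽 using (refl)
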